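{- Let $H=([r],E)$ be an undirected graph on $r$ vertices with edge set $E$, and let $m=|E|$. Let $\mathcal{C}_r$ be the collection of all Hamilton cycles in $H$, each regarded as an $r$-element subset of $E$. Any two distinct Hamilton cycles differ in at least four edges, so that $|C\oplus C'|>2$ for all distinct $C,C'\in\mathcal{C}_r$, and hence $\mathcal{C}_r$ defines a sparse paving matroid $(E,\mathcal{B})$ of rank $r$ on $E$, namely the one whose circuits of size $r$ are the members of $\mathcal{C}_r$ and whose set of bases $\mathcal{B}$ consists of all $r$-element subsets of $E$ not in $\mathcal{C}_r$. Furthermore, the number of Hamilton cycles in $H$ is equal to $|\mathcal{C}_r|=\binom{m}{r}-|\mathcal{B}|$.
   Context: Here $\oplus$ denotes symmetric difference. A matroid $(E,\mathcal{B})$ consists of a finite ground set $E$ and a collection $\mathcal{B}\subseteq 2^E$ of bases such that all bases have the same size $r$ (the rank), and for every pair of bases $X,Y\in\mathcal{B}$ and every $e\in X$ there exists $f\in Y$ such that $(X\setminus\{e\})\cup\{f\}\in\mathcal{B}$. A subset of $E$ is independent if it is a subset of some basis, and dependent otherwise; a circuit is a minimal (with respect to inclusion) dependent set. A matroid of rank $r$ is paving if all $(r-1)$-element subsets of $E$ are independent; then every $r$-element subset of $E$ is either a basis or a circuit, so the matroid is defined by its set of circuits with $r$ elements. A paving matroid of rank $r$ is sparse if $|C\oplus C'|>2$ for all distinct circuits $C,C'$ of size $r$.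
   Formalization: The sparse paving property and the identification of the size-r circuits with the Hamilton cycles are stated only when the set of bases is non-empty; otherwise they can fail, for example when H is a single r-cycle or a tree. -}

module Defs where

open import Level using (0ℓ)
open import Data.Nat using (ℕ; suc; _≤_; _<_)
open import Data.Nat.DivMod using (_mod_)
open import Data.Fin as Fin using (Fin; toℕ)
open import Data.Fin.Subset using (Subset; _∈_; _⊆_; _∪_; _─_; _-_; ⁅_⁆; ∣_∣; ⊤)
open import Data.List using (List; length)
import Data.List.Membership.Propositional as List
open import Data.List.Relation.Unary.Unique.Propositional using (Unique)
open import Data.Product using (_×_; _,_; ∃; proj₁; proj₂)
open import Data.Sum using (_⊎_)
open import Function using (_⇔_; Injective)
open import Relation.Nullary using (¬_)
open import Relation.Unary using (Pred)
open import Relation.Binary.PropositionalEquality using (_≡_; _≢_)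

private
  variable
    m n r : ℕ

infixl 5 _⊕_

_⊕_ : Subset n → Subset n → Subset n
X ⊕ Y = (X ─ Y) ∪ (Y ─ X)

-- P has exactly k elements: some list enumerates them without repetition.
HasCardinality : {A : Set} → Pred A 0ℓ → ℕ → Set
HasCardinality {A} P k =
  ∃ λ (xs : List A) → Unique xs × (∀ x → (x List.∈ xs) ⇔ P x) × length xs ≡ k

-- Matroids on the ground set Fin n.

SetSystem : ℕ → Set₁
SetSystem n = Pred (Subset n) 0ℓ

-- As in the definition used here, a family without any basis is not excluded.
record IsMatroid (r : ℕ) (𝓑 : SetSystem n) : Set where
  field
    rank     : ∀ {X} → 𝓑 X → ∣ X ∣ ≡ r
    exchange : ∀ {X Y} → 𝓑 X → 𝓑 Y → ∀ {e} → e ∈ X →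
               ∃ λ f → f ∈ Y × 𝓑 ((X - e) ∪ ⁅ f ⁆)

Independent : SetSystem n → Pred (Subset n) 0ℓ
Independent 𝓑 X = ∃ λ Y → 𝓑 Y × X ⊆ Y

Dependent : SetSystem n → Pred (Subset n) 0ℓ
Dependent 𝓑 X = ¬ Independent 𝓑 X

IsCircuit : SetSystem n → Pred (Subset n) 0ℓ
IsCircuit 𝓑 C = Dependent 𝓑 C × (∀ {D} → D ⊆ C → Dependent 𝓑 D → D ≡ C)

record IsPaving (r : ℕ) (𝓑 : SetSystem n) : Set where
  field
    isMatroid : IsMatroid r 𝓑
    -- The size condition is ∣ X ∣ = r - 1, with no truncation at r = 0.
    paving    : ∀ X → suc ∣ X ∣ ≡ r → Independent 𝓑 X

record IsSparsePaving (r : ℕ) (𝓑 : SetSystem n) : Set where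
  field
    isPaving : IsPaving r 𝓑
    sparse   : ∀ {C C′} → IsCircuit 𝓑 C → ∣ C ∣ ≡ r →
               IsCircuit 𝓑 C′ → ∣ C′ ∣ ≡ r →
               C ≢ C′ → 2 < ∣ C ⊕ C′ ∣

-- A simple undirected graph with vertex set Fin r and exactly m edges, which
-- are indexed by Fin m.  The edge {u , v} is stored once, as the pair (u , v)
-- with u < v; this rules out loops, and injectivity rules out parallel edges.
-- Sets of edges are thus elements of Subset m.
record SimpleGraph (r m : ℕ) : Set where
  field
    ends           : Fin m → Fin r × Fin r
    ends-ordered   : ∀ e → proj₁ (ends e) Fin.< proj₂ (ends e)
    ends-injective : Injective _≡_ _≡_ ends

Joins : SimpleGraph r m → Fin m → Fin r → Fin r → Set
Joins H e u v = ends e ≡ (u , v) ⊎ ends e ≡ (v , u)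
  where open SimpleGraph H

-- i ↦ i + 1 modulo n
next : Fin n → Fin n
next {suc n} i = suc (toℕ i) mod suc n

record Subgraph (r m : ℕ) : Set where
  constructor subgraph
  field
    vertices : Subset r
    edges    : Subset m

open Subgraph public

-- The subgraph G is a cycle of length k ≥ 3: its vertices are pairwise distinct
-- v 0 , … , v (k - 1) and its edges are v 0 v 1 , … , v (k - 1) v 0, all of
-- which are edges of H.
record IsCycle (H : SimpleGraph r m) (G : Subgraph r m) : Set where
  field
    k           : ℕ
    3≤k         : 3 ≤ k
    v           : Fin k → Fin r
    v-injective : Injective _≡_ _≡_ v
    adjacent    : ∀ i → ∃ λ e → Joins H e (v i) (v (next i))
    vertices⇔   : ∀ u → u ∈ vertices G ⇔ (∃ λ i → v i ≡ u)
    edges⇔      : ∀ e → e ∈ edges G ⇔ (∃ λ i → Joins H e (v i) (v (next i)))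

IsHamiltonCycle : SimpleGraph r m → Pred (Subgraph r m) 0ℓ
IsHamiltonCycle H G = IsCycle H G × vertices G ≡ ⊤

-- 𝒞 H is the collection 𝒞_r of edge sets of Hamilton cycles of H.
𝒞 : SimpleGraph r m → SetSystem m
𝒞 H C = ∃ λ G → IsHamiltonCycle H G × edges G ≡ C

𝓑 : SimpleGraph r m → SetSystem m
𝓑 {r} H X = ∣ X ∣ ≡ r × ¬ 𝒞 H X

{-# OPTIONS --safe #-}

-- A sparse family 𝓕 of r-subsets (distinct members differ in more than two
-- elements) contains at most one of the sets D ∪ ⁅ f ⁆ for a fixed D of size
-- r - 1.  So for a basis Y the set D extends by an element of Y to a basis:
-- if Y ─ D has two elements, one of them will do, and if it has only one, the
-- extension is Y itself.  This gives both the exchange axiom (D = X - e) and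
-- the paving condition.
--
-- Hamilton cycles are sparse because they are 2-regular: if C and C′ were to
-- differ only by replacing the edge e with f, then f would be incident to both
-- ends of e, hence equal to e.
module Submission where

open import Defs
open import Data.Nat using (ℕ; zero; suc; _+_; _∸_; _≤_; _<_; _^_; s≤s; z≤n)
open import Data.Nat.Properties as ℕ using (+-suc; +-cancelʳ-≡; suc-injective)
open import Data.Nat.Combinatorics using (_C_; nCk+nC[k+1]≡[n+1]C[k+1])
open import Data.Nat.DivMod using (_%_; m<n⇒m%n≡m; n%n≡0)
open import Data.Integer using (+_; _⊖_)
open import Data.Integer.Properties using (⊖-≥)
open import Data.Fin as Fin using (Fin; zero; suc; toℕ; fromℕ; inject₁; finToFun; funToFin)
open import Data.Fin.Properties as Fin using
  (toℕ<n; toℕ-injective; toℕ-fromℕ<; toℕ-fromℕ; toℕ-inject₁; injective⇒≤;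
   any?; all?; finToFun-funToFin)
open import Data.Fin.Subset using
  (Subset; inside; outside; _∈_; _∉_; _⊆_; _∪_; _─_; _-_; ⁅_⁆; ∣_∣; ⊤; Nonempty; Empty)
open import Data.Fin.Subset.Properties
open import Data.Vec using ([]; _∷_; here; there)
open import Data.Vec.Properties using (∷-injectiveʳ)
open import Data.List using (List; []; _∷_; _++_; length; map; filter)
open import Data.List.Properties using (length-map; length-++)
import Data.List.Membership.Propositional as List
open import Data.List.Membership.Propositional.Properties using
  (∈-map⁺; ∈-map⁻; ∈-++⁺ˡ; ∈-++⁺ʳ; ∈-++⁻; ∈-filter⁺; ∈-filter⁻)
open import Data.List.Relation.Unary.Any using (here)
open import Data.List.Relation.Unary.All using ([])
open import Data.List.Relation.Unary.AllPairs using ([]; _∷_)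
open import Data.List.Relation.Unary.Unique.Propositional using (Unique)
open import Data.List.Relation.Unary.Unique.Propositional.Properties using
  (map⁺; ++⁺; filter⁺)
open import Data.Product using (_×_; _,_; ∃; ∃₂; proj₁; proj₂)
open import Data.Product.Properties using (≡-dec; ,-injective)
open import Data.Sum using (_⊎_; inj₁; inj₂; swap)
open import Function using (_⇔_; mk⇔; Equivalence; Injective; _∘_)
open import Relation.Nullary using (¬_; Dec; yes; no; contradiction; ¬?)
open import Relation.Nullary.Decidable using
  (map′; _×-dec_; _⊎-dec_; _→-dec_; decidable-stable)
open import Relation.Unary using (Decidable; Satisfiable)
open import Relation.Binary.PropositionalEquality using
  (_≡_; _≢_; _≗_; refl; sym; trans; cong; cong₂; subst; subst₂; module ≡-Reasoning)

open Equivalence using (to; from)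

private
  variable
    k n : ℕ

-- Finite subsets

x∈p─q⇒x∉q : ∀ (p q : Subset n) {x} → x ∈ p ─ q → x ∉ q
x∈p─q⇒x∉q (_ ∷ p) (outside ∷ q) (there x∈) (there x∈q) = x∈p─q⇒x∉q p q x∈ x∈q
x∈p─q⇒x∉q (_ ∷ p) (inside  ∷ q) (there x∈) (there x∈q) = x∈p─q⇒x∉q p q x∈ x∈q

-- Both sides count `p ∪ q`. Cancelling a summand compares `∣ p ─ q ∣` with `∣ q ─ p ∣` once the
-- sizes of `p` and `q` are related, without subtraction in ℕ.
∣p─q∣+∣q∣≡∣q─p∣+∣p∣ : ∀ (p q : Subset n) → ∣ p ─ q ∣ + ∣ q ∣ ≡ ∣ q ─ p ∣ + ∣ p ∣
∣p─q∣+∣q∣≡∣q─p∣+∣p∣ []            []            = refl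
∣p─q∣+∣q∣≡∣q─p∣+∣p∣ (outside ∷ p) (outside ∷ q) = ∣p─q∣+∣q∣≡∣q─p∣+∣p∣ p q
∣p─q∣+∣q∣≡∣q─p∣+∣p∣ (outside ∷ p) (inside  ∷ q) =
  trans (+-suc _ _) (cong suc (∣p─q∣+∣q∣≡∣q─p∣+∣p∣ p q))
∣p─q∣+∣q∣≡∣q─p∣+∣p∣ (inside  ∷ p) (outside ∷ q) =
  trans (cong suc (∣p─q∣+∣q∣≡∣q─p∣+∣p∣ p q)) (sym (+-suc _ _))
∣p─q∣+∣q∣≡∣q─p∣+∣p∣ (inside  ∷ p) (inside  ∷ q) =
  trans (+-suc _ _) (trans (cong suc (∣p─q∣+∣q∣≡∣q─p∣+∣p∣ p q)) (sym (+-suc _ _)))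

∣p⊕q∣≡∣p─q∣+∣q─p∣ : ∀ (p q : Subset n) → ∣ p ⊕ q ∣ ≡ ∣ p ─ q ∣ + ∣ q ─ p ∣
∣p⊕q∣≡∣p─q∣+∣q─p∣ []            []            = refl
∣p⊕q∣≡∣p─q∣+∣q─p∣ (outside ∷ p) (outside ∷ q) = ∣p⊕q∣≡∣p─q∣+∣q─p∣ p q
∣p⊕q∣≡∣p─q∣+∣q─p∣ (outside ∷ p) (inside  ∷ q) =
  trans (cong suc (∣p⊕q∣≡∣p─q∣+∣q─p∣ p q)) (sym (+-suc _ _))
∣p⊕q∣≡∣p─q∣+∣q─p∣ (inside  ∷ p) (outside ∷ q) = cong suc (∣p⊕q∣≡∣p─q∣+∣q─p∣ p q)
∣p⊕q∣≡∣p─q∣+∣q─p∣ (inside  ∷ p) (inside  ∷ q) = ∣p⊕q∣≡∣p─q∣+∣q─p∣ p q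

x∈p⇒∣p∣≡1+∣p-x∣ : ∀ {p : Subset n} {x} → x ∈ p → ∣ p ∣ ≡ suc ∣ p - x ∣
x∈p⇒∣p∣≡1+∣p-x∣ {p = inside  ∷ p} here       = cong (suc ∘ ∣_∣) (sym (p─⊥≡p p))
x∈p⇒∣p∣≡1+∣p-x∣ {p = inside  ∷ p} (there x∈p) = cong suc (x∈p⇒∣p∣≡1+∣p-x∣ x∈p)
x∈p⇒∣p∣≡1+∣p-x∣ {p = outside ∷ p} (there x∈p) = x∈p⇒∣p∣≡1+∣p-x∣ x∈p

x∉p⇒∣p∪⁅x⁆∣≡1+∣p∣ : ∀ {p : Subset n} {x} → x ∉ p → ∣ p ∪ ⁅ x ⁆ ∣ ≡ suc ∣ p ∣
x∉p⇒∣p∪⁅x⁆∣≡1+∣p∣ {p = inside  ∷ p} {zero}  x∉p = contradiction here x∉p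
x∉p⇒∣p∪⁅x⁆∣≡1+∣p∣ {p = outside ∷ p} {zero}  x∉p = cong (suc ∘ ∣_∣) (∪-identityʳ p)
x∉p⇒∣p∪⁅x⁆∣≡1+∣p∣ {p = inside  ∷ p} {suc x} x∉p =
  cong suc (x∉p⇒∣p∪⁅x⁆∣≡1+∣p∣ (x∉p ∘ there))
x∉p⇒∣p∪⁅x⁆∣≡1+∣p∣ {p = outside ∷ p} {suc x} x∉p = x∉p⇒∣p∪⁅x⁆∣≡1+∣p∣ (x∉p ∘ there)

∣p∣≡0⇒x∉p : ∀ {p : Subset n} {x} → ∣ p ∣ ≡ 0 → x ∉ p
∣p∣≡0⇒x∉p ∣p∣≡0 x∈p = contradiction (trans (sym (x∈p⇒∣p∣≡1+∣p-x∣ x∈p)) ∣p∣≡0) λ ()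

∣p∣≡1⇒x≡y : ∀ {p : Subset n} {x y} → ∣ p ∣ ≡ 1 → x ∈ p → y ∈ p → x ≡ y
∣p∣≡1⇒x≡y {x = x} {y} ∣p∣≡1 x∈p y∈p = decidable-stable (x Fin.≟ y) λ x≢y →
  ∣p∣≡0⇒x∉p (suc-injective (trans (sym (x∈p⇒∣p∣≡1+∣p-x∣ y∈p)) ∣p∣≡1))
    (x∈p∧x≢y⇒x∈p-y x∈p x≢y)

Empty⇒∣p∣≡0 : ∀ {p : Subset n} → Empty p → ∣ p ∣ ≡ 0
Empty⇒∣p∣≡0 {n = n} empty = trans (cong ∣_∣ (Empty-unique empty)) (∣⊥∣≡0 n)

∣p∣≡1+k⇒nonempty : ∀ {p : Subset n} → ∣ p ∣ ≡ suc k → Nonempty p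
∣p∣≡1+k⇒nonempty {p = p} ∣p∣≡1+k = decidable-stable (nonempty? p) λ empty →
  contradiction (trans (sym ∣p∣≡1+k) (Empty⇒∣p∣≡0 empty)) λ ()

∣p∣≡2+k⇒distinct : ∀ {p : Subset n} → ∣ p ∣ ≡ suc (suc k) →
                   ∃₂ λ x y → x ∈ p × y ∈ p × x ≢ y
∣p∣≡2+k⇒distinct {p = p} ∣p∣≡2+k
  with x , x∈p ← ∣p∣≡1+k⇒nonempty ∣p∣≡2+k
  with y , y∈p-x ← ∣p∣≡1+k⇒nonempty
         (suc-injective (trans (sym (x∈p⇒∣p∣≡1+∣p-x∣ x∈p)) ∣p∣≡2+k))
  = x , y , x∈p , p─q⊆p p ⁅ x ⁆ y∈p-x ,
    λ { refl → x∈p─q⇒x∉q p ⁅ x ⁆ y∈p-x (x∈⁅x⁆ x) }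

∣p─q∣≡0⇒p⊆q : ∀ {p q : Subset n} → ∣ p ─ q ∣ ≡ 0 → p ⊆ q
∣p─q∣≡0⇒p⊆q {q = q} ∣p─q∣≡0 {x} x∈p = decidable-stable (x ∈? q) λ x∉q →
  ∣p∣≡0⇒x∉p ∣p─q∣≡0 (x∈p∧x∉q⇒x∈p─q x∈p x∉q)

p⊆q∧∣p∣≡∣q∣⇒p≡q : ∀ {p q : Subset n} → p ⊆ q → ∣ p ∣ ≡ ∣ q ∣ → p ≡ q
p⊆q∧∣p∣≡∣q∣⇒p≡q {p = p} p⊆q ∣p∣≡∣q∣ = ⊆-antisym p⊆q λ {x} x∈q →
  decidable-stable (x ∈? p) λ x∉p →
    contradiction ∣p∣≡∣q∣ (ℕ.<⇒≢ (p⊂q⇒∣p∣<∣q∣ (p⊆q , x , x∈q , x∉p)))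

-- The common part `p` cancels, so the symmetric difference lies in `⁅ x ⁆ ∪ ⁅ y ⁆`. This is the
-- bound that collides with sparsity.
∣p∪⁅x⁆⊕p∪⁅y⁆∣≤2 : ∀ (p : Subset n) {x y} → x ≢ y → ∣ (p ∪ ⁅ x ⁆) ⊕ (p ∪ ⁅ y ⁆) ∣ ≤ 2
∣p∪⁅x⁆⊕p∪⁅y⁆∣≤2 p {x} {y} x≢y =
  ℕ.≤-trans (p⊆q⇒∣p∣≤∣q∣ ⊕⊆) (ℕ.≤-reflexive
    (trans (x∉p⇒∣p∪⁅x⁆∣≡1+∣p∣ (x≢y ∘ sym ∘ x∈⁅y⁆⇒x≡y x)) (cong suc (∣⁅x⁆∣≡1 x))))
  where
  ─⊆ : ∀ a b → (p ∪ ⁅ a ⁆) ─ (p ∪ ⁅ b ⁆) ⊆ ⁅ a ⁆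
  ─⊆ a b z∈ with x∈p∪q⁻ p ⁅ a ⁆ (p─q⊆p (p ∪ ⁅ a ⁆) (p ∪ ⁅ b ⁆) z∈)
  ... | inj₁ z∈p = contradiction (p⊆p∪q ⁅ b ⁆ z∈p) (x∈p─q⇒x∉q (p ∪ ⁅ a ⁆) (p ∪ ⁅ b ⁆) z∈)
  ... | inj₂ z∈a = z∈a

  ⊕⊆ : (p ∪ ⁅ x ⁆) ⊕ (p ∪ ⁅ y ⁆) ⊆ ⁅ x ⁆ ∪ ⁅ y ⁆
  ⊕⊆ z∈ with x∈p∪q⁻ ((p ∪ ⁅ x ⁆) ─ (p ∪ ⁅ y ⁆)) ((p ∪ ⁅ y ⁆) ─ (p ∪ ⁅ x ⁆)) z∈
  ... | inj₁ z∈x = p⊆p∪q ⁅ y ⁆ (─⊆ x y z∈x)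
  ... | inj₂ z∈y = q⊆p∪q ⁅ x ⁆ ⁅ y ⁆ (─⊆ y x z∈y)

-- Induction on `k`: removing `f zero` from `p` leaves the image of `f ∘ suc`, by injectivity.
injective-image-card : ∀ {k} {p : Subset n} (f : Fin k → Fin n) → Injective _≡_ _≡_ f →
                       (∀ x → x ∈ p ⇔ (∃ λ i → f i ≡ x)) → ∣ p ∣ ≡ k
injective-image-card {k = zero} f f-inj image =
  Empty⇒∣p∣≡0 λ (x , x∈p) → contradiction (proj₁ (to (image x) x∈p)) λ ()
injective-image-card {k = suc k} {p} f f-inj image =
  trans (x∈p⇒∣p∣≡1+∣p-x∣ (from (image (f zero)) (zero , refl)))
        (cong suc (injective-image-card (f ∘ suc) (Fin.suc-injective ∘ f-inj) image′))
  where
  to′ : ∀ x → x ∈ p - f zero → ∃ λ i → f (suc i) ≡ x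
  to′ x x∈ with to (image x) (p─q⊆p p ⁅ f zero ⁆ x∈)
  ... | zero  , refl = contradiction (x∈⁅x⁆ (f zero)) (x∈p─q⇒x∉q p ⁅ f zero ⁆ x∈)
  ... | suc i , fi≡x = i , fi≡x

  image′ : ∀ x → x ∈ p - f zero ⇔ (∃ λ i → f (suc i) ≡ x)
  image′ x = mk⇔ (to′ x) λ { (i , refl) →
    x∈p∧x≢y⇒x∈p-y (from (image _) (suc i , refl)) (Fin.0≢1+n ∘ sym ∘ f-inj) }

-- Enumeration of the k-element subsets

kSubsets : ∀ n → ℕ → List (Subset n)
kSubsets zero    zero    = [] ∷ []
kSubsets zero    (suc k) = []
kSubsets (suc n) zero    = map (outside ∷_) (kSubsets n zero)
kSubsets (suc n) (suc k) =
  map (inside ∷_) (kSubsets n k) ++ map (outside ∷_) (kSubsets n (suc k))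

-- The recursion of `kSubsets` splits on membership of the first element, which is Pascal's rule.
length-kSubsets : ∀ n k → length (kSubsets n k) ≡ n C k
length-kSubsets zero    zero    = refl
length-kSubsets zero    (suc k) = refl
length-kSubsets (suc n) zero    = trans (length-map _ (kSubsets n zero)) (length-kSubsets n zero)
length-kSubsets (suc n) (suc k) = begin
  length (kSubsets (suc n) (suc k))
    ≡⟨ length-++ (map (inside ∷_) (kSubsets n k)) ⟩
  length (map (inside ∷_) (kSubsets n k)) + length (map (outside ∷_) (kSubsets n (suc k)))
    ≡⟨ cong₂ _+_ (length-map _ (kSubsets n k)) (length-map _ (kSubsets n (suc k))) ⟩
  length (kSubsets n k) + length (kSubsets n (suc k))
    ≡⟨ cong₂ _+_ (length-kSubsets n k) (length-kSubsets n (suc k)) ⟩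
  n C k + n C suc k
    ≡⟨ nCk+nC[k+1]≡[n+1]C[k+1] n k ⟩
  suc n C suc k ∎
  where open ≡-Reasoning

kSubsets-unique : ∀ n k → Unique (kSubsets n k)
kSubsets-unique zero    zero    = [] ∷ []
kSubsets-unique zero    (suc k) = []
kSubsets-unique (suc n) zero    = map⁺ ∷-injectiveʳ (kSubsets-unique n zero)
kSubsets-unique (suc n) (suc k) =
  ++⁺ (map⁺ ∷-injectiveʳ (kSubsets-unique n k))
      (map⁺ ∷-injectiveʳ (kSubsets-unique n (suc k)))
      disjoint
  where
  disjoint : ∀ {p} → ¬ (p List.∈ map (inside ∷_) (kSubsets n k) ×
                        p List.∈ map (outside ∷_) (kSubsets n (suc k)))
  disjoint (p∈ , p∈′) with ∈-map⁻ (inside ∷_) p∈ | ∈-map⁻ (outside ∷_) p∈′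
  ... | _ , _ , refl | _ , _ , ()

∈-kSubsets⁺ : ∀ (p : Subset n) → p List.∈ kSubsets n ∣ p ∣
∈-kSubsets⁺ []            = here refl
∈-kSubsets⁺ (inside ∷ p)  = ∈-++⁺ˡ (∈-map⁺ (inside ∷_) (∈-kSubsets⁺ p))
-- `kSubsets (suc n) k` reduces only when `k` is visibly zero or a successor, so `∣ p ∣` is
-- abstracted together with the induction hypothesis.
∈-kSubsets⁺ (outside ∷ p) with ∣ p ∣ | ∈-kSubsets⁺ p
... | zero  | p∈ = ∈-map⁺ (outside ∷_) p∈
... | suc k | p∈ = ∈-++⁺ʳ (map (inside ∷_) (kSubsets _ k)) (∈-map⁺ (outside ∷_) p∈)

∈-kSubsets⁻ : ∀ n k {p : Subset n} → p List.∈ kSubsets n k → ∣ p ∣ ≡ k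
∈-kSubsets⁻ zero    zero    (here refl) = refl
∈-kSubsets⁻ (suc n) zero    p∈ with ∈-map⁻ (outside ∷_) p∈
... | _ , q∈ , refl = ∈-kSubsets⁻ n zero q∈
∈-kSubsets⁻ (suc n) (suc k) p∈ with ∈-++⁻ (map (inside ∷_) (kSubsets n k)) p∈
... | inj₁ p∈ˡ with _ , q∈ , refl ← ∈-map⁻ (inside ∷_) p∈ˡ = cong suc (∈-kSubsets⁻ n k q∈)
... | inj₂ p∈ʳ with _ , q∈ , refl ← ∈-map⁻ (outside ∷_) p∈ʳ = ∈-kSubsets⁻ n (suc k) q∈

length-filter-¬ : ∀ {A : Set} {P : A → Set} (P? : Decidable P) xs →
                  length (filter P? xs) + length (filter (¬? ∘ P?) xs) ≡ length xs
length-filter-¬ P? []       = refl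
length-filter-¬ P? (x ∷ xs) with P? x
... | yes _ = cong suc (length-filter-¬ P? xs)
... | no  _ = trans (+-suc _ _) (cong suc (length-filter-¬ P? xs))

-- Sparse families of r-subsets

module SparseFamily
  {n r} (𝓕 : SetSystem n) (𝓕? : Decidable 𝓕)
  (𝓕-size : ∀ {X} → 𝓕 X → ∣ X ∣ ≡ r)
  (𝓕-sparse : ∀ {X Y} → 𝓕 X → 𝓕 Y → X ≢ Y → 2 < ∣ X ⊕ Y ∣)
  where

  Bases : SetSystem n
  Bases X = ∣ X ∣ ≡ r × ¬ 𝓕 X

  -- Since `x ∉ D` and `x ≢ y`, the element `x` separates the two extensions. They are therefore
  -- distinct members of `𝓕` at distance at most two.
  at-most-one-extension : ∀ {D x y} → x ∉ D → x ≢ y → 𝓕 (D ∪ ⁅ x ⁆) → ¬ 𝓕 (D ∪ ⁅ y ⁆)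
  at-most-one-extension {D} {x} {y} x∉D x≢y 𝓕x 𝓕y =
    ℕ.<⇒≱ (𝓕-sparse 𝓕x 𝓕y D∪x≢D∪y) (∣p∪⁅x⁆⊕p∪⁅y⁆∣≤2 D x≢y)
    where
    D∪x≢D∪y : D ∪ ⁅ x ⁆ ≢ D ∪ ⁅ y ⁆
    D∪x≢D∪y eq with x∈p∪q⁻ D ⁅ y ⁆ (subst (x ∈_) eq (q⊆p∪q D ⁅ x ⁆ (x∈⁅x⁆ x)))
    ... | inj₁ x∈D = x∉D x∈D
    ... | inj₂ x∈y = x≢y (x∈⁅y⁆⇒x≡y y x∈y)

  extend : ∀ {D Y} → suc ∣ D ∣ ≡ r → Bases Y → ∃ λ f → f ∈ Y × Bases (D ∪ ⁅ f ⁆)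
  extend {D} {Y} 1+∣D∣≡r (∣Y∣≡r , ¬𝓕Y) = go ∣ D ─ Y ∣ refl
    where
    ∈Y : ∀ {x} → x ∈ Y ─ D → x ∈ Y
    ∈Y = p─q⊆p Y D

    ∉D : ∀ {x} → x ∈ Y ─ D → x ∉ D
    ∉D = x∈p─q⇒x∉q Y D

    size : ∀ {x} → x ∈ Y ─ D → ∣ D ∪ ⁅ x ⁆ ∣ ≡ r
    size x∈ = trans (x∉p⇒∣p∪⁅x⁆∣≡1+∣p∣ (∉D x∈)) 1+∣D∣≡r

    -- `Y` has one element more than `D`, so `∣ D ─ Y ∣` tells how many candidates `Y` offers:
    -- exactly one if it is zero, at least two otherwise.
    ∣Y─D∣≡1+∣D─Y∣ : ∣ Y ─ D ∣ ≡ suc ∣ D ─ Y ∣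
    ∣Y─D∣≡1+∣D─Y∣ = +-cancelʳ-≡ ∣ D ∣ _ _
      (trans (∣p─q∣+∣q∣≡∣q─p∣+∣p∣ Y D)
      (trans (cong (λ k → ∣ D ─ Y ∣ + k) (trans ∣Y∣≡r (sym 1+∣D∣≡r)))
             (+-suc _ _)))

    go : ∀ k → ∣ D ─ Y ∣ ≡ k → ∃ λ f → f ∈ Y × Bases (D ∪ ⁅ f ⁆)
    go zero ∣D─Y∣≡0 with x , x∈ ← ∣p∣≡1+k⇒nonempty ∣Y─D∣≡1+∣D─Y∣ =
      x , ∈Y x∈ , size x∈ , ¬𝓕Y ∘ subst 𝓕 D∪x≡Y
      where
      D∪x⊆Y : D ∪ ⁅ x ⁆ ⊆ Y
      D∪x⊆Y z∈ with x∈p∪q⁻ D ⁅ x ⁆ z∈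
      ... | inj₁ z∈D = ∣p─q∣≡0⇒p⊆q ∣D─Y∣≡0 z∈D
      ... | inj₂ z∈x = subst (_∈ Y) (sym (x∈⁅y⁆⇒x≡y x z∈x)) (∈Y x∈)

      D∪x≡Y : D ∪ ⁅ x ⁆ ≡ Y
      D∪x≡Y = p⊆q∧∣p∣≡∣q∣⇒p≡q D∪x⊆Y (trans (size x∈) (sym ∣Y∣≡r))
    go (suc k) ∣D─Y∣≡1+k
      with x , y , x∈ , y∈ , x≢y ← ∣p∣≡2+k⇒distinct (trans ∣Y─D∣≡1+∣D─Y∣ (cong suc ∣D─Y∣≡1+k))
      with 𝓕? (D ∪ ⁅ x ⁆)
    ... | no ¬𝓕x = x , ∈Y x∈ , size x∈ , ¬𝓕x
    ... | yes 𝓕x = y , ∈Y y∈ , size y∈ , at-most-one-extension (∉D x∈) x≢y 𝓕x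

  isMatroid : IsMatroid r Bases
  isMatroid = record
    { rank     = proj₁
    ; exchange = λ (∣X∣≡r , _) BY e∈X →
        extend (trans (sym (x∈p⇒∣p∣≡1+∣p-x∣ e∈X)) ∣X∣≡r) BY
    }

  circuit⇒𝓕 : ∀ {C} → IsCircuit Bases C → ∣ C ∣ ≡ r → 𝓕 C
  circuit⇒𝓕 {C} (dep , _) ∣C∣≡r = decidable-stable (𝓕? C) λ ¬𝓕C →
    dep (C , (∣C∣≡r , ¬𝓕C) , ⊆-refl)

  -- Independence means lying in a basis, so without bases every set is dependent and the paving
  -- condition can fail. For the triangle this happens: its only 3-element set of edges is a
  -- Hamilton cycle. The exchange axiom above holds in any case.
  module _ (satisfiable : Satisfiable Bases) where

    isPaving : IsPaving r Bases
    isPaving = record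
      { isMatroid = isMatroid
      ; paving    = λ X 1+∣X∣≡r →
          let f , _ , BXf = extend 1+∣X∣≡r (proj₂ satisfiable)
          in X ∪ ⁅ f ⁆ , BXf , p⊆p∪q ⁅ f ⁆
      }

    -- A basis containing `C` would have the same size and hence equal `C`, so `C` is dependent;
    -- minimality comes from the paving condition.
    𝓕⇒circuit : ∀ {C} → 𝓕 C → IsCircuit Bases C
    𝓕⇒circuit {C} 𝓕C = dependent , minimal
      where
      dependent : Dependent Bases C
      dependent (Y , (∣Y∣≡r , ¬𝓕Y) , C⊆Y) =
        ¬𝓕Y (subst 𝓕 (p⊆q∧∣p∣≡∣q∣⇒p≡q C⊆Y (trans (𝓕-size 𝓕C) (sym ∣Y∣≡r))) 𝓕C)

      minimal : ∀ {D} → D ⊆ C → Dependent Bases D → D ≡ C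
      minimal {D} D⊆C dep = ⊆-antisym D⊆C λ {e} e∈C → decidable-stable (e ∈? D) λ e∉D →
        -- A subset `D` of `C` missing `e` lies in `C - e`, which has size `r - 1` and is thus
        -- independent.
        let Y , BY , C-e⊆Y = IsPaving.paving isPaving (C - e)
                               (trans (sym (x∈p⇒∣p∣≡1+∣p-x∣ e∈C)) (𝓕-size 𝓕C))
        in dep (Y , BY , λ x∈D → C-e⊆Y (x∈p∧x≢y⇒x∈p-y (D⊆C x∈D) λ { refl → e∉D x∈D }))

    isSparsePaving : IsSparsePaving r Bases
    isSparsePaving = record
      { isPaving = isPaving
      ; sparse   = λ circ ∣C∣≡r circ′ ∣C′∣≡r →
          𝓕-sparse (circuit⇒𝓕 circ ∣C∣≡r) (circuit⇒𝓕 circ′ ∣C′∣≡r)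
      }

    circuits⇔𝓕 : ∀ C → (IsCircuit Bases C × ∣ C ∣ ≡ r) ⇔ 𝓕 C
    circuits⇔𝓕 C = mk⇔ (λ (circ , ∣C∣≡r) → circuit⇒𝓕 circ ∣C∣≡r)
                       (λ 𝓕C → 𝓕⇒circuit 𝓕C , 𝓕-size 𝓕C)

  -- Counting the family and its bases

  𝓕-list Bases-list : List (Subset n)
  𝓕-list     = filter 𝓕? (kSubsets n r)
  Bases-list = filter (¬? ∘ 𝓕?) (kSubsets n r)

  𝓕-card : HasCardinality 𝓕 (length 𝓕-list)
  𝓕-card = 𝓕-list , filter⁺ 𝓕? (kSubsets-unique n r) , enumerates , refl
    where
    enumerates : ∀ X → X List.∈ 𝓕-list ⇔ 𝓕 X
    enumerates X = mk⇔ (proj₂ ∘ ∈-filter⁻ 𝓕? {xs = kSubsets n r}) λ 𝓕X →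
      ∈-filter⁺ 𝓕? (subst (λ k → X List.∈ kSubsets n k) (𝓕-size 𝓕X) (∈-kSubsets⁺ X)) 𝓕X

  Bases-card : HasCardinality Bases (length Bases-list)
  Bases-card = Bases-list , filter⁺ (¬? ∘ 𝓕?) (kSubsets-unique n r) , enumerates , refl
    where
    enumerates : ∀ X → X List.∈ Bases-list ⇔ Bases X
    enumerates X = mk⇔
      (λ X∈ → let X∈k , ¬𝓕X = ∈-filter⁻ (¬? ∘ 𝓕?) {xs = kSubsets n r} X∈
              in ∈-kSubsets⁻ n r X∈k , ¬𝓕X)
      (λ (∣X∣≡r , ¬𝓕X) → ∈-filter⁺ (¬? ∘ 𝓕?)
        (subst (λ k → X List.∈ kSubsets n k) ∣X∣≡r (∈-kSubsets⁺ X)) ¬𝓕X)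

  -- The two lists partition the `r`-subsets. The difference is taken in ℤ, so the equation loses
  -- nothing to truncated subtraction.
  count : + length 𝓕-list ≡ (n C r) ⊖ length Bases-list
  count = begin
    + c                    ≡⟨ cong +_ (sym (ℕ.m+n∸n≡m c b)) ⟩
    + (c + b ∸ b)          ≡⟨ sym (⊖-≥ (ℕ.m≤n+m b c)) ⟩
    (c + b) ⊖ b            ≡⟨ cong (_⊖ b) (trans (length-filter-¬ 𝓕? (kSubsets n r))
                                                 (length-kSubsets n r)) ⟩
    (n C r) ⊖ b            ∎
    where
    open ≡-Reasoning
    c = length 𝓕-list
    b = length Bases-list

-- The cyclic successor

-- Separating the wrap-around from the ordinary step removes the modulus: what follows about `next`
-- needs only successor arithmetic.
next-cases : (i : Fin n) → (suc (toℕ i) < n × toℕ (next i) ≡ suc (toℕ i))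
                         ⊎ (suc (toℕ i) ≡ n × toℕ (next i) ≡ 0)
next-cases {suc n} i with ℕ.m≤n⇒m<n∨m≡n (toℕ<n i)
... | inj₁ 1+i<n = inj₁ (1+i<n , trans (toℕ-fromℕ< _) (m<n⇒m%n≡m 1+i<n))
... | inj₂ 1+i≡n =
  inj₂ (1+i≡n , trans (toℕ-fromℕ< _) (trans (cong (_% suc n) 1+i≡n) (n%n≡0 (suc n))))

next-injective : ∀ {i j : Fin n} → next i ≡ next j → i ≡ j
next-injective {i = i} {j} eq with next-cases i | next-cases j
... | inj₁ (_ , i′) | inj₁ (_ , j′) =
  toℕ-injective (suc-injective (trans (sym i′) (trans (cong toℕ eq) j′)))
... | inj₁ (_ , i′) | inj₂ (_ , j′) =
  contradiction (trans (sym i′) (trans (cong toℕ eq) j′)) λ ()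
... | inj₂ (_ , i′) | inj₁ (_ , j′) =
  contradiction (trans (sym i′) (trans (cong toℕ eq) j′)) λ ()
... | inj₂ (i′ , _) | inj₂ (j′ , _) = toℕ-injective (suc-injective (trans i′ (sym j′)))

next-surjective : ∀ (j : Fin n) → ∃ λ i → next i ≡ j
next-surjective {suc n} zero with next-cases (fromℕ n)
... | inj₁ (lt , _) = contradiction (subst (λ k → suc k < suc n) (toℕ-fromℕ n) lt) (ℕ.<-irrefl refl)
... | inj₂ (_ , eq) = fromℕ n , toℕ-injective eq
next-surjective {suc n} (suc j) with next-cases (inject₁ j)
... | inj₁ (_ , eq) = inject₁ j , toℕ-injective (trans eq (cong suc (toℕ-inject₁ j)))
... | inj₂ (eq , _) =
  contradiction (trans (sym (toℕ-inject₁ j)) (suc-injective eq)) (ℕ.<⇒≢ (toℕ<n j))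

next≢ : 3 ≤ n → ∀ (i : Fin n) → next i ≢ i
next≢ 3≤n i eq with next-cases i
... | inj₁ (_ , i′) = ℕ.1+n≢n (trans (sym i′) (cong toℕ eq))
... | inj₂ (1+i≡n , i′) =
  ℕ.<⇒≢ (ℕ.<-trans (s≤s (s≤s z≤n)) 3≤n) (trans (cong suc (trans (sym i′) (cong toℕ eq))) 1+i≡n)

-- Without wrap-around `i + 2` would equal `i`; one wrap-around forces `n = 2`, and two force
-- `n = 1`.
next²≢ : 3 ≤ n → ∀ (i : Fin n) → next (next i) ≢ i
next²≢ 3≤n i eq with next-cases i | next-cases (next i)
... | inj₁ (_ , i′) | inj₁ (_ , i″) =
  ℕ.m≢1+n+m (toℕ i) {1} (trans (sym (cong toℕ eq)) (trans i″ (cong suc i′)))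
... | inj₁ (_ , i′) | inj₂ (1+i′≡n , i″) =
  ℕ.<⇒≢ 3≤n (trans (cong suc (sym (trans i′ (cong suc (trans (sym (cong toℕ eq)) i″))))) 1+i′≡n)
... | inj₂ (1+i≡n , i′) | inj₁ (_ , i″) =
  ℕ.<⇒≢ 3≤n (trans (cong suc (sym (trans (sym (cong toℕ eq)) (trans i″ (cong suc i′))))) 1+i≡n)
... | inj₂ (_ , i′) | inj₂ (1+i′≡n , _) =
  ℕ.<⇒≢ (ℕ.<-trans (s≤s (s≤s z≤n)) 3≤n) (trans (cong suc (sym i′)) 1+i′≡n)

-- Hamilton cycles

module HamiltonCycles {r m} (H : SimpleGraph r m) where
  open SimpleGraph H

  _≟ₑ_ : ∀ (p q : Fin r × Fin r) → Dec (p ≡ q)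
  _≟ₑ_ = ≡-dec Fin._≟_ Fin._≟_

  Joins? : ∀ e u v → Dec (Joins H e u v)
  Joins? e u v = (ends e ≟ₑ (u , v)) ⊎-dec (ends e ≟ₑ (v , u))

  -- If `e` and `f` store the ends in the same order, `ends-injective` applies; opposite orders
  -- would contradict `ends-ordered`.
  Joins-edge-unique : ∀ {e f u v} → Joins H e u v → Joins H f u v → e ≡ f
  Joins-edge-unique         (inj₁ p) (inj₁ q) = ends-injective (trans p (sym q))
  Joins-edge-unique {e} {f} (inj₁ p) (inj₂ q) =
    contradiction (subst (λ (u , v) → u Fin.< v) q (ends-ordered f))
                  (Fin.<-asym (subst (λ (u , v) → u Fin.< v) p (ends-ordered e)))
  Joins-edge-unique {e} {f} (inj₂ p) (inj₁ q) =
    contradiction (subst (λ (u , v) → u Fin.< v) q (ends-ordered f))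
                  (Fin.<-asym (subst (λ (u , v) → u Fin.< v) p (ends-ordered e)))
  Joins-edge-unique         (inj₂ p) (inj₂ q) = ends-injective (trans p (sym q))

  Joins-ends-unique : ∀ {e u v u′ v′} → Joins H e u v → Joins H e u′ v′ →
                      (u ≡ u′ × v ≡ v′) ⊎ (u ≡ v′ × v ≡ u′)
  Joins-ends-unique (inj₁ p) (inj₁ q) = inj₁ (,-injective (trans (sym p) q))
  Joins-ends-unique (inj₁ p) (inj₂ q) = inj₂ (,-injective (trans (sym p) q))
  Joins-ends-unique (inj₂ p) (inj₁ q) =
    let v≡u′ , u≡v′ = ,-injective (trans (sym p) q) in inj₂ (u≡v′ , v≡u′)
  Joins-ends-unique (inj₂ p) (inj₂ q) =
    let v≡v′ , u≡u′ = ,-injective (trans (sym p) q) in inj₁ (u≡u′ , v≡v′)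

  Incident : Fin m → Fin r → Set
  Incident e u = ∃ λ w → Joins H e u w

  -- The ends `u` and `v` of `e` differ because they are strictly ordered. So they are the two
  -- distinct ends of `f`, and there are no parallel edges.
  incident-both-ends : ∀ {e f u v} → Joins H e u v → Incident f u → Incident f v → e ≡ f
  incident-both-ends {e} ee@(inj₁ eq) (w , fu) (w′ , fv) with Joins-ends-unique fu fv
  ... | inj₁ (refl , _) =
    contradiction (subst (λ (u , v) → u Fin.< v) eq (ends-ordered e)) (Fin.<-irrefl refl)
  ... | inj₂ (_ , refl) = Joins-edge-unique ee fu
  incident-both-ends {e} ee@(inj₂ eq) (w , fu) (w′ , fv) with Joins-ends-unique fu fv
  ... | inj₁ (refl , _) =
    contradiction (subst (λ (u , v) → u Fin.< v) eq (ends-ordered e)) (Fin.<-irrefl refl)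
  ... | inj₂ (_ , refl) = Joins-edge-unique ee fu

  -- Two-regular edge sets and their distance

  TwoRegular : Subset m → Set
  TwoRegular A = ∀ u → ∃₂ λ a b →
    a ≢ b × (a ∈ A × Incident a u) × (b ∈ A × Incident b u) ×
    (∀ {c} → c ∈ A → Incident c u → c ≡ a ⊎ c ≡ b)

  TwoRegular-≤2 : ∀ {A u x y z} → TwoRegular A →
                  x ∈ A → Incident x u → y ∈ A → Incident y u → z ∈ A → Incident z u →
                  x ≢ y → x ≢ z → ¬ (y ≢ z)
  TwoRegular-≤2 {u = u} reg x∈ xu y∈ yu z∈ zu x≢y x≢z y≢z
    with _ , _ , _ , _ , _ , only ← reg u
    with only x∈ xu | only y∈ yu | only z∈ zu
  ... | inj₁ refl | inj₁ refl | _         = x≢y refl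
  ... | inj₁ refl | inj₂ _    | inj₁ refl = x≢z refl
  ... | inj₁ _    | inj₂ refl | inj₂ refl = y≢z refl
  ... | inj₂ _    | inj₁ refl | inj₁ refl = y≢z refl
  ... | inj₂ refl | inj₁ _    | inj₂ refl = x≢z refl
  ... | inj₂ refl | inj₂ refl | _         = x≢y refl

  -- Of the two edges of `A′` at `u`, one lies outside `A` and so is `f`. Otherwise both of them and
  -- `e`, which is distinct from them because `e ∉ A′`, would be three edges of `A` at `u`.
  TwoRegular-swap-incident :
    ∀ {A A′ e f u} → TwoRegular A → TwoRegular A′ → e ∈ A → e ∉ A′ →
    (∀ {x} → x ∈ A′ → x ∉ A → x ≡ f) → Incident e u → Incident f u
  TwoRegular-swap-incident {A} {u = u} reg reg′ e∈A e∉A′ A′─A eu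
    with a , b , a≢b , (a∈A′ , au) , (b∈A′ , bu) , _ ← reg′ u
    with a ∈? A | b ∈? A
  ... | no a∉A  | _       = subst (λ x → Incident x u) (A′─A a∈A′ a∉A) au
  ... | yes _   | no b∉A  = subst (λ x → Incident x u) (A′─A b∈A′ b∉A) bu
  ... | yes a∈A | yes b∈A =
    contradiction (λ { refl → e∉A′ b∈A′ })
      (TwoRegular-≤2 reg a∈A au b∈A bu e∈A eu a≢b λ { refl → e∉A′ a∈A′ })

  -- Equal sizes make the two differences equally large, say of size `k`, so the distance is `2k`.
  -- Here `k = 0` gives `A ≡ A′`, and `k = 1` is the replacement of one edge `e` by one edge `f`;
  -- what remains is `k ≥ 2`.
  TwoRegular-distance : ∀ {A A′} → TwoRegular A → TwoRegular A′ → ∣ A ∣ ≡ ∣ A′ ∣ →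
                        A ≢ A′ → 4 ≤ ∣ A ⊕ A′ ∣
  TwoRegular-distance {A} {A′} reg reg′ ∣A∣≡∣A′∣ A≢A′ =
    subst (4 ≤_) (sym (∣p⊕q∣≡∣p─q∣+∣q─p∣ A A′)) (go ∣ A ─ A′ ∣ refl)
    where
    ∣A′─A∣≡ : ∣ A′ ─ A ∣ ≡ ∣ A ─ A′ ∣
    ∣A′─A∣≡ = +-cancelʳ-≡ ∣ A ∣ _ _
      (trans (∣p─q∣+∣q∣≡∣q─p∣+∣p∣ A′ A) (cong (λ k → ∣ A ─ A′ ∣ + k) (sym ∣A∣≡∣A′∣)))

    go : ∀ k → ∣ A ─ A′ ∣ ≡ k → 4 ≤ ∣ A ─ A′ ∣ + ∣ A′ ─ A ∣
    go 0 eq = contradiction (p⊆q∧∣p∣≡∣q∣⇒p≡q (∣p─q∣≡0⇒p⊆q eq) ∣A∣≡∣A′∣) A≢A′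
    go 1 eq
      with e , e∈ ← ∣p∣≡1+k⇒nonempty eq
         | f , f∈ ← ∣p∣≡1+k⇒nonempty (trans ∣A′─A∣≡ eq)
      = contradiction (subst (_∈ A) e≡f e∈A) (x∈p─q⇒x∉q A′ A f∈)
      where
      e∈A : e ∈ A
      e∈A = p─q⊆p A A′ e∈

      f-incident : ∀ {u} → Incident e u → Incident f u
      f-incident = TwoRegular-swap-incident reg reg′ e∈A (x∈p─q⇒x∉q A A′ e∈)
        λ x∈A′ x∉A → ∣p∣≡1⇒x≡y (trans ∣A′─A∣≡ eq) (x∈p∧x∉q⇒x∈p─q x∈A′ x∉A) f∈

      e≡f : e ≡ f
      e≡f = incident-both-ends (inj₁ refl) (f-incident (_ , inj₁ refl)) (f-incident (_ , inj₂ refl))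
    go (suc (suc k)) eq = ℕ.+-mono-≤ 2≤ (subst (2 ≤_) (sym ∣A′─A∣≡) 2≤)
      where
      2≤ : 2 ≤ ∣ A ─ A′ ∣
      2≤ = subst (2 ≤_) (sym eq) (s≤s (s≤s z≤n))

  -- Cyclic vertex orders and decidability of Hamiltonicity

  record HamiltonOrder (A : Subset m) (v : Fin r → Fin r) : Set where
    field
      3≤r        : 3 ≤ r
      injective  : ∀ i j → v i ≡ v j → i ≡ j
      surjective : ∀ u → ∃ λ i → v i ≡ u
      adjacent   : ∀ i → ∃ λ e → Joins H e (v i) (v (next i))
      complete   : ∀ e → e ∈ A → ∃ λ i → Joins H e (v i) (v (next i))
      sound      : ∀ e → (∃ λ i → Joins H e (v i) (v (next i))) → e ∈ A

  -- Needed because coding a function as an element of `Fin (r ^ r)` and decoding it returns it only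
  -- up to `≗`.
  HamiltonOrder-resp-≗ : ∀ {A v w} → v ≗ w → HamiltonOrder A v → HamiltonOrder A w
  HamiltonOrder-resp-≗ {A} {v} {w} v≗w o = record
    { 3≤r        = O.3≤r
    ; injective  = λ i j eq → O.injective i j (trans (v≗w i) (trans eq (sym (v≗w j))))
    ; surjective = λ u → let i , eq = O.surjective u in i , trans (sym (v≗w i)) eq
    ; adjacent   = λ i → let e , j = O.adjacent i in e , joins j
    ; complete   = λ e e∈A → let i , j = O.complete e e∈A in i , joins j
    ; sound      = λ e (i , j) →
        O.sound e (i , subst₂ (Joins H e) (sym (v≗w i)) (sym (v≗w (next i))) j)
    }
    where
    module O = HamiltonOrder o

    joins : ∀ {e i} → Joins H e (v i) (v (next i)) → Joins H e (w i) (w (next i))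
    joins {e} {i} = subst₂ (Joins H e) (v≗w i) (v≗w (next i))

  -- With the length fixed at `r` and the edge set given directly, every field of `HamiltonOrder` is
  -- a numerical comparison or quantifies over finite sets only.
  HamiltonOrder? : ∀ A v → Dec (HamiltonOrder A v)
  HamiltonOrder? A v = map′
    (λ (a , b , c , d , e , f) → record
      { 3≤r = a ; injective = b ; surjective = c ; adjacent = d ; complete = e ; sound = f })
    (λ o → let open HamiltonOrder o in
      3≤r , injective , surjective , adjacent , complete , sound)
    (3 ℕ.≤? r
      ×-dec all? (λ i → all? λ j → (v i Fin.≟ v j) →-dec (i Fin.≟ j))
      ×-dec all? (λ u → any? λ i → v i Fin.≟ u)
      ×-dec all? (λ i → any? λ e → Joins? e (v i) (v (next i)))
      ×-dec all? (λ e → (e ∈? A) →-dec any? λ i → Joins? e (v i) (v (next i)))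
      ×-dec all? (λ e → (any? λ i → Joins? e (v i) (v (next i))) →-dec (e ∈? A)))

  -- Exhaustive search through the `r ^ r` maps from `Fin r` to itself, each represented by its
  -- code.
  ∃HamiltonOrder? : ∀ A → Dec (∃ (HamiltonOrder A))
  ∃HamiltonOrder? A = map′
    (λ (c , o) → finToFun c , o)
    (λ (v , o) → funToFin v , HamiltonOrder-resp-≗ (sym ∘ finToFun-funToFin v) o)
    (any? λ (c : Fin (r ^ r)) → HamiltonOrder? A (finToFun c))

  order⇒cycle : ∀ {A} → ∃ (HamiltonOrder A) → IsHamiltonCycle H (subgraph ⊤ A)
  order⇒cycle (v , o) = record
    { k           = r
    ; 3≤k         = 3≤r
    ; v           = v
    ; v-injective = injective _ _
    ; adjacent    = adjacent
    ; vertices⇔   = λ u → mk⇔ (λ _ → surjective u) (λ _ → ∈⊤)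
    ; edges⇔      = λ e → mk⇔ (complete e) (sound e)
    } , refl
    where open HamiltonOrder o

  cycle⇒order : ∀ {G} → IsHamiltonCycle H G → ∃ (HamiltonOrder (edges G))
  cycle⇒order {G} (cycle , vertices≡⊤) = order cycle len≡r
    where
    open IsCycle cycle renaming (k to len)

    v-surjective : ∀ u → ∃ λ i → v i ≡ u
    v-surjective u = to (vertices⇔ u) (subst (u ∈_) (sym vertices≡⊤) ∈⊤)

    -- `v` is injective, and so is its right inverse given by surjectivity; the two injections bound
    -- each length by the other.
    len≡r : len ≡ r
    len≡r = ℕ.≤-antisym (injective⇒≤ v-injective) (injective⇒≤ {f = proj₁ ∘ v-surjective}
      λ {x} {y} eq →
        trans (sym (proj₂ (v-surjective x))) (trans (cong v eq) (proj₂ (v-surjective y))))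

    -- The cycle is taken as a fresh argument and opened as a record, so that its length becomes a
    -- variable which `refl` can identify with `r`.
    order : (cyc : IsCycle H G) → IsCycle.k cyc ≡ r → ∃ (HamiltonOrder (edges G))
    order record { 3≤k = 3≤k ; v = v ; v-injective = v-inj ; adjacent = adj
                 ; vertices⇔ = vertices⇔ ; edges⇔ = edges⇔ } refl = v , record
      { 3≤r        = 3≤k
      ; injective  = λ _ _ → v-inj
      ; surjective = λ u → to (vertices⇔ u) (subst (u ∈_) (sym vertices≡⊤) ∈⊤)
      ; adjacent   = adj
      ; complete   = to ∘ edges⇔
      ; sound      = from ∘ edges⇔
      }

  order⇒𝒞 : ∀ {A} → ∃ (HamiltonOrder A) → 𝒞 H A
  order⇒𝒞 {A} o = subgraph ⊤ A , order⇒cycle o , refl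

  𝒞⇒order : ∀ {A} → 𝒞 H A → ∃ (HamiltonOrder A)
  𝒞⇒order (G , ham , refl) = cycle⇒order ham

  𝒞? : Decidable (𝒞 H)
  𝒞? A = map′ order⇒𝒞 𝒞⇒order (∃HamiltonOrder? A)

  -- Size and degrees along a cyclic order

  module Order {A v} (o : HamiltonOrder A v) where
    open HamiltonOrder o

    edge : Fin r → Fin m
    edge i = proj₁ (adjacent i)

    edge-joins : ∀ i → Joins H (edge i) (v i) (v (next i))
    edge-joins i = proj₂ (adjacent i)

    edge-∈ : ∀ i → edge i ∈ A
    edge-∈ i = sound _ (i , edge-joins i)

    -- An edge shared by positions `i` and `j` either has the same first end at both, giving
    -- `i ≡ j`, or is traversed in opposite directions. The latter makes each position the successor
    -- of the other, which a cycle of length at least three forbids.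
    edge-injective : ∀ {i j} → edge i ≡ edge j → i ≡ j
    edge-injective {i} {j} eq
      with Joins-ends-unique (edge-joins i)
             (subst (λ e → Joins H e (v j) (v (next j))) (sym eq) (edge-joins j))
    ... | inj₁ (vi≡vj , _) = injective _ _ vi≡vj
    ... | inj₂ (vi≡vj⁺ , vi⁺≡vj) = contradiction
      (trans (cong next (injective _ _ vi⁺≡vj)) (sym (injective _ _ vi≡vj⁺))) (next²≢ 3≤r i)

    size : ∣ A ∣ ≡ r
    size = injective-image-card edge edge-injective λ e → mk⇔
      (λ e∈A → let i , j = complete e e∈A in i , Joins-edge-unique (edge-joins i) j)
      (λ { (i , refl) → edge-∈ i })

    twoRegular : TwoRegular A
    twoRegular u
      -- Writing `u` as `v (next i)` exposes its predecessor `v i`, so the two edges at `u` are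
      -- those at positions `i` and `next i`.
      with j , refl ← surjective u
      with i , refl ← next-surjective j
      = edge i , edge (next i)
      , (λ eq → next≢ 3≤r i (sym (edge-injective eq)))
      , (edge-∈ i , v i , swap (edge-joins i))
      , (edge-∈ (next i) , _ , edge-joins (next i))
      , only
      where
      only : ∀ {c} → c ∈ A → Incident c (v (next i)) → c ≡ edge i ⊎ c ≡ edge (next i)
      only {c} c∈A (w , cu)
        with l , cl ← complete c c∈A
        -- The vertex is either the first end of the edge at position `l`, whence `l` is `next i`,
        -- or its second end, whence `l` is `i`.
        with Joins-ends-unique cu cl
      ... | inj₁ (eq , _) with refl ← injective _ _ eq = inj₂ (Joins-edge-unique cl (edge-joins _))
      ... | inj₂ (eq , _) with refl ← next-injective (injective _ _ eq) =
        inj₁ (Joins-edge-unique cl (edge-joins _))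

  𝒞-size : ∀ {A} → 𝒞 H A → ∣ A ∣ ≡ r
  𝒞-size 𝒞C = Order.size (proj₂ (𝒞⇒order 𝒞C))

  𝒞-distance : ∀ {A A′} → 𝒞 H A → 𝒞 H A′ → A ≢ A′ → 4 ≤ ∣ A ⊕ A′ ∣
  𝒞-distance 𝒞C 𝒞C′ = TwoRegular-distance
    (Order.twoRegular (proj₂ (𝒞⇒order 𝒞C))) (Order.twoRegular (proj₂ (𝒞⇒order 𝒞C′)))
    (trans (𝒞-size 𝒞C) (sym (𝒞-size 𝒞C′)))

  -- The vertex set of a Hamilton cycle is `⊤`, so the subgraph is determined by its edge set and
  -- `subgraph ⊤` is a bijection from `𝒞 H` to the Hamilton cycles.
  hamiltonCycles-card : ∀ {c} → HasCardinality (𝒞 H) c → HasCardinality (IsHamiltonCycle H) c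
  hamiltonCycles-card (Cs , unique , enumerates , length≡c) =
    map (subgraph ⊤) Cs , map⁺ (cong edges) unique , enumerates′ ,
    trans (length-map (subgraph ⊤) Cs) length≡c
    where
    to′ : ∀ G → G List.∈ map (subgraph ⊤) Cs → IsHamiltonCycle H G
    to′ G G∈ with A , A∈ , refl ← ∈-map⁻ (subgraph ⊤) G∈ =
      order⇒cycle (𝒞⇒order (to (enumerates A) A∈))

    from′ : ∀ G → IsHamiltonCycle H G → G List.∈ map (subgraph ⊤) Cs
    from′ G@(subgraph _ A) ham@(_ , refl) =
      ∈-map⁺ (subgraph ⊤) (from (enumerates A) (G , ham , refl))

    enumerates′ : ∀ G → G List.∈ map (subgraph ⊤) Cs ⇔ IsHamiltonCycle H G
    enumerates′ G = mk⇔ (to′ G) (from′ G)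

mainTheorem3 : ∀ {r m : ℕ} (H : SimpleGraph r m) →
    (∀ {C : Subset m} → 𝒞 H C → ∣ C ∣ ≡ r)
    × (∀ {C C′ : Subset m} → 𝒞 H C → 𝒞 H C′ → C ≢ C′ →
    4 ≤ ∣ C ⊕ C′ ∣ × 2 < ∣ C ⊕ C′ ∣)
    × IsMatroid r (𝓑 H)
    × (Satisfiable (𝓑 H) →
    IsSparsePaving r (𝓑 H)
    × (∀ (C : Subset m) → (IsCircuit (𝓑 H) C × ∣ C ∣ ≡ r) ⇔ 𝒞 H C))
    × (∃ λ h → ∃ λ c → ∃ λ b →
    HasCardinality (IsHamiltonCycle H) h
    × HasCardinality (𝒞 H) c
    × HasCardinality (𝓑 H) b
    × h ≡ c
    × + c ≡ (m C r) ⊖ b)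
mainTheorem3 H =
  -- As `4 ≤ x` is `3 < x` and `2 < x` is `3 ≤ x`, weakening by `ℕ.<⇒≤` turns the first bound into
  -- the second.
  𝒞-size , (λ 𝒞C 𝒞C′ C≢C′ → let d = 𝒞-distance 𝒞C 𝒞C′ C≢C′ in d , ℕ.<⇒≤ d) ,
  isMatroid , (λ satisfiable → isSparsePaving satisfiable , circuits⇔𝓕 satisfiable) ,
  (_ , _ , _ , hamiltonCycles-card 𝓕-card , 𝓕-card , Bases-card , refl , count)
  where
  open HamiltonCycles H
  open SparseFamily (𝒞 H) 𝒞? 𝒞-size (λ 𝒞C 𝒞C′ C≢C′ → ℕ.<⇒≤ (𝒞-distance 𝒞C 𝒞C′ C≢C′))
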